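{- Let $G$ be a finite simple graph with $n$ vertices, $m$ edges, and degree sequence $d(1),\dots,d(n)$. Then \[ \left(6k_3(G)-\sum_{i=1}^n d^2(i)+nm\right)\, bk(G)\;\ge\; n\,k_3(G)+8k_4(G)+2k_4^{(3)}(G). \]
   Context: A book of size $q$ is a set of $q$ triangles sharing a common edge; the booksize $bk(G)$ is the size of the largest book in $G$, i.e. the maximum over edges $uv$ of the number of common neighbours of $u$ and $v$. $k_s(G)$ denotes the number of $s$-cliques of $G$ (so $k_3(G)$ is the number of triangles and $k_4(G)$ the number of copies of $K_4$). $k_4^{(3)}(G)$ denotes the number of 4-vertex subsets of $V(G)$ inducing a subgraph isomorphic to a triangle together with an isolated vertex. -}

module Defs where

open import Data.Fin using (Fin; #_)
open import Data.Fin.Properties using (_≟_; _<?_; any?; all?)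
open import Data.Fin.Subset using (Subset; _∈_; _∩_; ∣_∣; inside; outside)
open import Data.Fin.Subset.Properties using (_∈?_)
open import Data.List as List using (List; length; filter; cartesianProduct; allFin)
open import Data.List.Extrema.Nat using (max)
open import Data.Nat using (ℕ; zero; suc; _^_)
open import Data.Nat.ListAction using (sum)
import Data.Nat as ℕ
open import Data.Product using (∃; _×_; _,_; uncurry)
open import Data.Vec as Vec using (Vec; []; _∷_; lookup)
open import Function using (_∘_)
open import Level using (0ℓ)
open import Relation.Binary using (Rel; Decidable; Symmetric; Irreflexive)
open import Relation.Binary.PropositionalEquality using (_≡_; _≢_; sym)
open import Relation.Nullary using (Dec; does; ¬?; _×-dec_; _→-dec_)
open import Relation.Nullary.Decidable using (map′)
import Relation.Unary as U

record Graph (n : ℕ) : Set₁ where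
  field
    Adj     : Rel (Fin n) 0ℓ
    adj?    : Decidable Adj
    adj-sym : Symmetric Adj
    irrefl  : Irreflexive _≡_ Adj

open Graph public

module _ {n : ℕ} (G : Graph n) where

  neighbours : Fin n → Subset n
  neighbours v = Vec.tabulate λ u → does (adj? G v u)

  degree : Fin n → ℕ
  degree v = ∣ neighbours v ∣

  -- Each edge is listed once, with its smaller endpoint first.
  edges : List (Fin n × Fin n)
  edges = filter (uncurry λ u v → (u <? v) ×-dec adj? G u v)
                 (cartesianProduct (allFin n) (allFin n))

  edgeCount : ℕ
  edgeCount = length edges

  sumSquaredDegrees : ℕ
  sumSquaredDegrees = sum (List.map (λ v → degree v ^ 2) (allFin n))

  codegree : Fin n → Fin n → ℕ
  codegree u v = ∣ neighbours u ∩ neighbours v ∣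

  -- The triangles on an edge uv correspond to the common neighbours of u and v.
  -- The value is 0 when there are no edges.
  bk : ℕ
  bk = max 0 (List.map (uncurry codegree) edges)

allSubsets : ∀ n → List (Subset n)
allSubsets zero    = List.[ [] ]
allSubsets (suc n) = List.map (outside ∷_) (allSubsets n) List.++
                     List.map (inside  ∷_) (allSubsets n)

countSubsets : ∀ {n} {P : Subset n → Set} → U.Decidable P → ℕ
countSubsets {n} P? = length (filter P? (allSubsets n))

module _ {n : ℕ} (G : Graph n) where

  IsClique : ℕ → Subset n → Set
  IsClique s S =
    ∣ S ∣ ≡ s × (∀ u → u ∈ S → ∀ v → v ∈ S → u ≢ v → Adj G u v)

  isClique? : ∀ s → U.Decidable (IsClique s)
  isClique? s S =
    (∣ S ∣ ℕ.≟ s) ×-dec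
    all? λ u → (u ∈? S) →-dec
    all? λ v → (v ∈? S) →-dec (¬? (u ≟ v) →-dec adj? G u v)

  k : ℕ → ℕ
  k s = countSubsets (isClique? s)

module _ {h n : ℕ} (H : Graph h) (G : Graph n) where

  -- φ, given by its table of values, is an isomorphism from H onto the
  -- subgraph of G induced by S.
  IsInducedIso : Subset n → Vec (Fin n) h → Set
  IsInducedIso S φ =
    (∀ i → lookup φ i ∈ S) ×
    (∀ i j → lookup φ i ≡ lookup φ j → i ≡ j) ×
    (∀ v → v ∈ S → ∃ λ i → lookup φ i ≡ v) ×
    (∀ i j → Adj H i j → Adj G (lookup φ i) (lookup φ j)) ×
    (∀ i j → Adj G (lookup φ i) (lookup φ j) → Adj H i j)

  isInducedIso? : ∀ S → U.Decidable (IsInducedIso S)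
  isInducedIso? S φ =
    all? (λ i → lookup φ i ∈? S) ×-dec
    all? (λ i → all? λ j → (lookup φ i ≟ lookup φ j) →-dec (i ≟ j)) ×-dec
    all? (λ v → (v ∈? S) →-dec any? λ i → lookup φ i ≟ v) ×-dec
    all? (λ i → all? λ j → adj? H i j →-dec adj? G (lookup φ i) (lookup φ j)) ×-dec
    all? (λ i → all? λ j → adj? G (lookup φ i) (lookup φ j) →-dec adj? H i j)

  InducesCopy : Subset n → Set
  InducesCopy S = ∃ (IsInducedIso S)

anyVec? : ∀ {n h} {P : Vec (Fin n) h → Set} → U.Decidable P → Dec (∃ P)
anyVec? {h = zero}  P? = map′ ([] ,_) (λ { ([] , p) → p }) (P? [])
anyVec? {h = suc h} P? =
  map′ (λ { (x , xs , p) → x ∷ xs , p }) (λ { (x ∷ xs , p) → x , xs , p })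
       (any? λ x → anyVec? (P? ∘ (x ∷_)))

inducedCount : ∀ {h n} → Graph h → Graph n → ℕ
inducedCount H G = countSubsets λ S → anyVec? (isInducedIso? H G S)

-- The triangle on 0, 1, 2 together with the isolated vertex 3.
triangle+isolated : Graph 4
triangle+isolated = record
  { Adj     = λ i j → i ≢ j × i ≢ # 3 × j ≢ # 3
  ; adj?    = λ i j → ¬? (i ≟ j) ×-dec ¬? (i ≟ # 3) ×-dec ¬? (j ≟ # 3)
  ; adj-sym = λ { (i≢j , i≢3 , j≢3) → (λ j≡i → i≢j (sym j≡i)) , j≢3 , i≢3 }
  ; irrefl  = λ { i≡j (i≢j , _) → i≢j i≡j }
  }

k₄⁽³⁾ : ∀ {n} → Graph n → ℕ
k₄⁽³⁾ = inducedCount triangle+isolated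

{-# OPTIONS --safe #-}
-- Call a vertex x and an edge uv agreeing if x is adjacent to both or to neither of u, v.
-- Counting agreeing pairs by inclusion-exclusion gives 6 k₃ − Σ d² + n m. Weighting each
-- pair by the codegree of its edge costs at most a factor bk, and the weighted count is the
-- number of triples (T, e, x) with T a triangle, e an edge of T and x agreeing with e. For a
-- fixed T, a vertex x agrees with three edges of T if it is adjacent to all of T or to none
-- of it, and with exactly one edge otherwise, so the weighted count equals
-- n k₃ + 2 (4 k₄ + k₄⁽³⁾).
--
-- All counts are taken over ordered tuples. A tuple count of embeddings of H is the number
-- of induced copies of H times the number of automorphisms of H: 6, 24 and 6 for the
-- triangle, K₄ and the triangle with an isolated vertex.

module Submission where

open import Defs
open import Data.Nat using (ℕ)
open import Data.Bool using (Bool; true; false; _∧_; not; _xor_)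
import Data.Bool.Properties as Bool
open import Data.Empty using (⊥-elim)
open import Data.Fin using (Fin; zero; suc; _<_)
open import Data.Fin.Properties using (_≟_; _<?_; <-cmp; all?; any?; suc-injective)
open import Data.Fin.Subset using (Subset; _∈_; ∣_∣; inside; outside; ⊤; _∩_)
open import Data.Fin.Subset.Properties using (∈⊤; ⊆-antisym; ∩-comm)
import Data.Integer.Properties as ℤ
open import Data.Integer.Tactic.RingSolver using (solve-∀)
open import Data.List as List using (List; []; _∷_; length; filter; cartesianProduct)
open import Data.List.Extrema.Nat using (xs≤max)
open import Data.List.Membership.Propositional.Properties
  using (∈-map⁺; ∈-filter⁺; ∈-cartesianProduct⁺; ∈-allFin)
open import Data.List.Properties using (filter-++; length-++)
import Data.List.Relation.Unary.All as All
import Data.Nat as ℕ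
open import Data.Nat.ListAction using () renaming (sum to sumᴸ)
import Data.Nat.Properties as ℕ
open import Data.Product using (∃; _×_; _,_; uncurry)
open import Data.Vec as Vec using (Vec; []; _∷_; lookup; here; there)
open import Data.Vec.Properties as Vec using (lookup-map; lookup∘tabulate; lookup-zipWith)
open import Function using (_∘_; _⇔_; mk⇔; id)
open import Function.Definitions using (Injective)
open import Relation.Binary.Definitions using (tri<; tri≈; tri>)
open import Relation.Binary.PropositionalEquality
open import Relation.Nullary using (Dec; yes; no; does; ¬_; ¬?; _×-dec_; _→-dec_)
open import Relation.Nullary.Decidable using (from-yes; dec-true; dec-false; does-⇔)
import Relation.Unary as U
open import Algebra.Properties.Semiring.Sum ℕ.+-*-semiring

module Counting where

  open import Data.Nat using (zero; suc; _+_; _*_; _^_; _≤_; z≤n)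

  private
    variable
      m n h s : ℕ

  -- Indicators and finite sums over vertices.

  𝟙 : Bool → ℕ
  𝟙 false = 0
  𝟙 true  = 1

  𝟙-∧ : ∀ a b → 𝟙 (a ∧ b) ≡ 𝟙 a * 𝟙 b
  𝟙-∧ false b = refl
  𝟙-∧ true  b = sym (ℕ.+-identityʳ (𝟙 b))

  𝟙-dec-true : ∀ {P : Set} (P? : Dec P) → P → 𝟙 (does P?) ≡ 1
  𝟙-dec-true P? p = cong 𝟙 (dec-true P? p)

  𝟙-dec-false : ∀ {P : Set} (P? : Dec P) → ¬ P → 𝟙 (does P?) ≡ 0
  𝟙-dec-false P? ¬p = cong 𝟙 (dec-false P? ¬p)

  𝟙-dec-⇔ : ∀ {P Q : Set} → P ⇔ Q → (P? : Dec P) (Q? : Dec Q) → 𝟙 (does P?) ≡ 𝟙 (does Q?)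
  𝟙-dec-⇔ P⇔Q P? Q? = cong 𝟙 (does-⇔ P⇔Q P? Q?)

  ∑-zero : {F : Fin n → ℕ} → (∀ i → F i ≡ 0) → sum F ≡ 0
  ∑-zero {n} F≡0 = trans (sum-cong-≗ F≡0) (sum-replicate-zero n)

  ∑-const : ∀ n c → ∑[ i < n ] c ≡ n * c
  ∑-const zero    c = refl
  ∑-const (suc n) c = cong (c +_) (∑-const n c)

  ∑-point : {F : Fin n → ℕ} (i : Fin n) → (∀ j → i ≢ j → F j ≡ 0) → sum F ≡ F i
  ∑-point {F = F} zero F≡0 =
    trans (cong (F zero +_) (∑-zero λ j → F≡0 (suc j) λ ())) (ℕ.+-identityʳ _)
  ∑-point (suc i) F≡0 =
    cong₂ _+_ (F≡0 zero λ ()) (∑-point i λ j i≢j → F≡0 (suc j) (i≢j ∘ suc-injective))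

  -- Each `F u` is spread over the indices `i` with `f i ≡ u`: by injectivity there is at most one,
  -- and where there is none `F u` vanishes. Exchanging the two sums then gives the claim.
  ∑-reindex : (f : Fin m → Fin n) → Injective _≡_ _≡_ f → (F : Fin n → ℕ) →
              (∀ u → (∀ i → f i ≢ u) → F u ≡ 0) → sum F ≡ sum (F ∘ f)
  ∑-reindex {m} {n} f f-injective F F≡0 = begin
    ∑[ u < n ] F u                                   ≡⟨ sum-cong-≗ expand ⟩
    ∑[ u < n ] ∑[ i < m ] (𝟙 (does (f i ≟ u)) * F u) ≡⟨ ∑-comm (λ u i → 𝟙 (does (f i ≟ u)) * F u) ⟩
    ∑[ i < m ] ∑[ u < n ] (𝟙 (does (f i ≟ u)) * F u) ≡⟨ sum-cong-≗ contract ⟩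
    ∑[ i < m ] F (f i)                               ∎
    where
    open ≡-Reasoning

    on : ∀ {u v} → u ≡ v → 𝟙 (does (u ≟ v)) * F v ≡ F v
    on {u} {v} u≡v = trans (cong (_* F v) (𝟙-dec-true (u ≟ v) u≡v)) (ℕ.*-identityˡ (F v))

    off : ∀ {u v} → u ≢ v → 𝟙 (does (u ≟ v)) * F v ≡ 0
    off {u} {v} u≢v = cong (_* F v) (𝟙-dec-false (u ≟ v) u≢v)

    expand : ∀ u → F u ≡ ∑[ i < m ] (𝟙 (does (f i ≟ u)) * F u)
    expand u with any? (λ i → f i ≟ u)
    ... | yes (i , refl) = sym (trans
      (∑-point {F = λ j → 𝟙 (does (f j ≟ f i)) * F (f i)} i
               λ j i≢j → off λ fj≡fi → i≢j (sym (f-injective fj≡fi)))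
      (on refl))
    ... | no ∄i = trans (F≡0 u λ i fi≡u → ∄i (i , fi≡u))
                        (sym (∑-zero λ i → off λ fi≡u → ∄i (i , fi≡u)))

    contract : ∀ i → ∑[ u < n ] (𝟙 (does (f i ≟ u)) * F u) ≡ F (f i)
    contract i = trans (∑-point (f i) λ u → off) (on refl)

  -- Sums over tuples and over subsets.

  ∑ᵛ : ∀ h → (Vec (Fin n) h → ℕ) → ℕ
  ∑ᵛ         zero    F = F []
  ∑ᵛ {n = n} (suc h) F = ∑[ u < n ] ∑ᵛ h (F ∘ (u ∷_))

  ∑ᵛ-cong : ∀ h {F F′ : Vec (Fin n) h → ℕ} → F ≗ F′ → ∑ᵛ h F ≡ ∑ᵛ h F′
  ∑ᵛ-cong zero    F≗F′ = F≗F′ []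
  ∑ᵛ-cong (suc h) F≗F′ = sum-cong-≗ λ u → ∑ᵛ-cong h (F≗F′ ∘ (u ∷_))

  ∑ᵛ-zero : ∀ h {F : Vec (Fin n) h → ℕ} → (∀ φ → F φ ≡ 0) → ∑ᵛ h F ≡ 0
  ∑ᵛ-zero zero    F≡0 = F≡0 []
  ∑ᵛ-zero (suc h) F≡0 = ∑-zero λ u → ∑ᵛ-zero h (F≡0 ∘ (u ∷_))

  ∑ᵛ-distrib-+ : ∀ h (F F′ : Vec (Fin n) h → ℕ) →
                 ∑ᵛ h (λ φ → F φ + F′ φ) ≡ ∑ᵛ h F + ∑ᵛ h F′
  ∑ᵛ-distrib-+ zero    F F′ = refl
  ∑ᵛ-distrib-+ (suc h) F F′ = trans
    (sum-cong-≗ λ u → ∑ᵛ-distrib-+ h (F ∘ (u ∷_)) (F′ ∘ (u ∷_)))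
    (∑-distrib-+ (λ u → ∑ᵛ h (F ∘ (u ∷_))) (λ u → ∑ᵛ h (F′ ∘ (u ∷_))))

  -- `∑-reindex` applied coordinate by coordinate. It restricts a sum over tuples of vertices of `G`
  -- to the tuples inside one copy of `H`.
  ∑ᵛ-reindex : (f : Fin m → Fin n) → Injective _≡_ _≡_ f → ∀ h (F : Vec (Fin n) h → ℕ) →
               (∀ φ i → (∀ j → f j ≢ lookup φ i) → F φ ≡ 0) →
               ∑ᵛ h F ≡ ∑ᵛ h (F ∘ Vec.map f)
  ∑ᵛ-reindex f f-injective zero    F F≡0 = refl
  ∑ᵛ-reindex f f-injective (suc h) F F≡0 = trans
    (∑-reindex f f-injective (λ u → ∑ᵛ h (F ∘ (u ∷_)))
               λ u u∉f → ∑ᵛ-zero h λ φ → F≡0 (u ∷ φ) zero u∉f)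
    (sum-cong-≗ λ j → ∑ᵛ-reindex f f-injective h (F ∘ (f j ∷_))
                                 λ φ i → F≡0 (f j ∷ φ) (suc i))

  -- The recursion follows that of `allSubsets`, so that counting subsets with a given property
  -- becomes summing an indicator.
  ∑ˢ : (Subset n → ℕ) → ℕ
  ∑ˢ {zero}  F = F []
  ∑ˢ {suc n} F = ∑ˢ (F ∘ (outside ∷_)) + ∑ˢ (F ∘ (inside ∷_))

  ∑ˢ-cong : {F F′ : Subset n → ℕ} → F ≗ F′ → ∑ˢ F ≡ ∑ˢ F′
  ∑ˢ-cong {zero}  F≗F′ = F≗F′ []
  ∑ˢ-cong {suc n} F≗F′ =
    cong₂ _+_ (∑ˢ-cong (F≗F′ ∘ (outside ∷_))) (∑ˢ-cong (F≗F′ ∘ (inside ∷_)))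

  ∑ˢ-zero : {F : Subset n → ℕ} → (∀ S → F S ≡ 0) → ∑ˢ F ≡ 0
  ∑ˢ-zero {zero}  F≡0 = F≡0 []
  ∑ˢ-zero {suc n} F≡0 =
    cong₂ _+_ (∑ˢ-zero (F≡0 ∘ (outside ∷_))) (∑ˢ-zero (F≡0 ∘ (inside ∷_)))

  ∑ˢ-point : {F : Subset n → ℕ} (S : Subset n) → (∀ T → S ≢ T → F T ≡ 0) → ∑ˢ F ≡ F S
  ∑ˢ-point []                F≡0 = refl
  ∑ˢ-point {F = F} (outside ∷ S) F≡0 = trans
    (cong₂ _+_ (∑ˢ-point S λ T S≢T → F≡0 (outside ∷ T) (S≢T ∘ Vec.∷-injectiveʳ))
               (∑ˢ-zero λ T → F≡0 (inside ∷ T) λ ()))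
    (ℕ.+-identityʳ (F (outside ∷ S)))
  ∑ˢ-point (inside ∷ S) F≡0 =
    cong₂ _+_ (∑ˢ-zero λ T → F≡0 (outside ∷ T) λ ())
              (∑ˢ-point S λ T S≢T → F≡0 (inside ∷ T) (S≢T ∘ Vec.∷-injectiveʳ))

  *-distribˡ-∑ˢ : ∀ c (F : Subset n → ℕ) → c * ∑ˢ F ≡ ∑ˢ (λ S → c * F S)
  *-distribˡ-∑ˢ {zero}  c F = refl
  *-distribˡ-∑ˢ {suc n} c F = trans
    (ℕ.*-distribˡ-+ c (∑ˢ (F ∘ (outside ∷_))) (∑ˢ (F ∘ (inside ∷_))))
    (cong₂ _+_ (*-distribˡ-∑ˢ c (F ∘ (outside ∷_))) (*-distribˡ-∑ˢ c (F ∘ (inside ∷_))))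

  ∑ˢ-∑ᵛ-comm : ∀ {n m} h (F : Subset m → Vec (Fin n) h → ℕ) →
               ∑ˢ (λ S → ∑ᵛ h (F S)) ≡ ∑ᵛ h (λ φ → ∑ˢ λ S → F S φ)
  ∑ˢ-∑ᵛ-comm {m = zero}  h F = refl
  ∑ˢ-∑ᵛ-comm {m = suc m} h F = trans
    (cong₂ _+_ (∑ˢ-∑ᵛ-comm h (F ∘ (outside ∷_))) (∑ˢ-∑ᵛ-comm h (F ∘ (inside ∷_))))
    (sym (∑ᵛ-distrib-+ h (λ φ → ∑ˢ λ S → F (outside ∷ S) φ) (λ φ → ∑ˢ λ S → F (inside ∷ S) φ)))

  -- Counts of subsets as sums of indicators.

  length-filter-map : ∀ {A B : Set} {P : B → Set} (P? : U.Decidable P) (f : A → B) xs →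
                      length (filter P? (List.map f xs)) ≡ length (filter (P? ∘ f) xs)
  length-filter-map P? f []       = refl
  length-filter-map P? f (x ∷ xs) with does (P? (f x))
  ... | true  = cong suc (length-filter-map P? f xs)
  ... | false = length-filter-map P? f xs

  length-filter-++ : ∀ {A : Set} {P : A → Set} (P? : U.Decidable P) xs ys →
                     length (filter P? (xs List.++ ys)) ≡
                     length (filter P? xs) + length (filter P? ys)
  length-filter-++ P? xs ys =
    trans (cong length (filter-++ P? xs ys)) (length-++ (filter P? xs))

  countSubsets≡∑ˢ : {P : Subset n → Set} (P? : U.Decidable P) →
                    countSubsets P? ≡ ∑ˢ (𝟙 ∘ does ∘ P?)
  countSubsets≡∑ˢ {zero} P? with does (P? [])
  ... | true  = refl
  ... | false = refl
  countSubsets≡∑ˢ {suc n} P? = trans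
    (length-filter-++ P? (List.map (outside ∷_) (allSubsets n)) _)
    (cong₂ _+_
      (trans (length-filter-map P? (outside ∷_) (allSubsets n)) (countSubsets≡∑ˢ (P? ∘ (outside ∷_))))
      (trans (length-filter-map P? (inside ∷_) (allSubsets n)) (countSubsets≡∑ˢ (P? ∘ (inside ∷_)))))

  ∑-lookup : (S : Subset n) → ∑[ u < n ] 𝟙 (lookup S u) ≡ ∣ S ∣
  ∑-lookup []            = refl
  ∑-lookup (inside  ∷ S) = cong suc (∑-lookup S)
  ∑-lookup (outside ∷ S) = ∑-lookup S

  -- Embeddings, induced copies and automorphisms.

  module _ (H : Graph h) (G : Graph n) where

    -- Not required to be injective: for twin-free H, injectivity is automatic.
    IsEmbedding : Vec (Fin n) h → Set
    IsEmbedding φ =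
      (∀ i j → Adj H i j → Adj G (lookup φ i) (lookup φ j)) ×
      (∀ i j → Adj G (lookup φ i) (lookup φ j) → Adj H i j)

    isEmbedding? : U.Decidable IsEmbedding
    isEmbedding? φ =
      all? (λ i → all? λ j → adj? H i j →-dec adj? G (lookup φ i) (lookup φ j)) ×-dec
      all? (λ i → all? λ j → adj? G (lookup φ i) (lookup φ j) →-dec adj? H i j)

  -- An induced isomorphism from `H` onto the whole of `H` is an automorphism. For a concrete `H`
  -- the number is found by evaluation.
  automorphismCount : Graph h → ℕ
  automorphismCount {h} H = ∑ᵛ h (𝟙 ∘ does ∘ isInducedIso? H H ⊤)

  -- Distinct vertices have distinct neighbourhoods. Comparing Booleans makes the condition
  -- decidable, so that it is settled by evaluation for a concrete `H`.
  TwinFree : Graph h → Set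
  TwinFree H = ∀ i j → (∀ k → does (adj? H i k) ≡ does (adj? H j k)) → i ≡ j

  twinFree? : (H : Graph h) → Dec (TwinFree H)
  twinFree? H = all? λ i → all? λ j →
    all? (λ k → does (adj? H i k) Bool.≟ does (adj? H j k)) →-dec (i ≟ j)

  image : Vec (Fin n) h → Subset n
  image φ = Vec.tabulate λ u → does (any? λ i → lookup φ i ≟ u)

  lookup∈image : (φ : Vec (Fin n) h) → ∀ i → lookup φ i ∈ image φ
  lookup∈image φ i = Vec.lookup⇒[]= (lookup φ i) (image φ)
    (trans (lookup∘tabulate _ (lookup φ i)) (dec-true (any? λ j → lookup φ j ≟ lookup φ i) (i , refl)))

  ∈image⇒lookup : (φ : Vec (Fin n) h) → ∀ {u} → u ∈ image φ → ∃ λ i → lookup φ i ≡ u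
  ∈image⇒lookup φ {u} u∈φ with any? (λ i → lookup φ i ≟ u) in eq
  ... | yes p = p
  ... | no ¬p with () ← trans (sym (Vec.[]=⇒lookup u∈φ))
                              (trans (lookup∘tabulate _ u) (cong does eq))

  module _ (H : Graph h) (G : Graph n) where

    -- Adjacency in `H` can be read off in `G` through `φ`, so two vertices with the same image have
    -- the same neighbours in `H`.
    isEmbedding⇒injective : TwinFree H → ∀ φ → IsEmbedding H G φ →
                            ∀ i j → lookup φ i ≡ lookup φ j → i ≡ j
    isEmbedding⇒injective twinFree φ (to , from) i j φi≡φj =
      twinFree i j λ k → does-⇔
        (mk⇔ (λ ik → from j k (subst (λ u → Adj G u (lookup φ k)) φi≡φj (to i k ik)))
             (λ jk → from i k (subst (λ u → Adj G u (lookup φ k)) (sym φi≡φj) (to j k jk))))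
        (adj? H i k) (adj? H j k)

    isInducedIso⇒≡image : ∀ S φ → IsInducedIso H G S φ → image φ ≡ S
    isInducedIso⇒≡image S φ (φ∈S , _ , onto , _) = ⊆-antisym
      (λ u∈φ → let i , φi≡u = ∈image⇒lookup φ u∈φ in subst (_∈ S) φi≡u (φ∈S i))
      (λ {u} u∈S → let i , φi≡u = onto u u∈S in subst (_∈ image φ) φi≡u (lookup∈image φ i))

    -- A tuple can be an isomorphism onto the subgraph induced by `S` only if `S` is its image. For
    -- that `S`, membership and surjectivity are automatic and injectivity follows from
    -- twin-freeness.
    ∑ˢ-isInducedIso : TwinFree H → ∀ φ →
      ∑ˢ (λ S → 𝟙 (does (isInducedIso? H G S φ))) ≡ 𝟙 (does (isEmbedding? H G φ))
    ∑ˢ-isInducedIso twinFree φ = trans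
      (∑ˢ-point (image φ) λ S φ≢S →
        𝟙-dec-false (isInducedIso? H G S φ) λ iso → φ≢S (isInducedIso⇒≡image S φ iso))
      (𝟙-dec-⇔
        (mk⇔ (λ (_ , _ , _ , embeds) → embeds)
             (λ embeds → lookup∈image φ , isEmbedding⇒injective twinFree φ embeds ,
                         (λ u → ∈image⇒lookup φ) , embeds))
        (isInducedIso? H G (image φ) φ) (isEmbedding? H G φ))

    -- Composition with one fixed isomorphism `φ` onto `S` matches the automorphisms of `H` with the
    -- isomorphisms onto `S` that factor through `φ`.
    isInducedIso-map : ∀ S φ → IsInducedIso H G S φ → ∀ ψ →
      IsInducedIso H G S (Vec.map (lookup φ) ψ) ⇔ IsInducedIso H H ⊤ ψ
    isInducedIso-map S φ (φ∈S , φ-injective , φ-onto , φ-to , φ-from) ψ = mk⇔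
      (λ (_ , injective , onto , to , from) →
        (λ _ → ∈⊤) ,
        (λ i j ψi≡ψj → injective i j (trans (at i) (trans (cong (lookup φ) ψi≡ψj) (sym (at j))))) ,
        (λ v _ → let i , eq = onto (lookup φ v) (φ∈S v) in
                 i , φ-injective _ _ (trans (sym (at i)) eq)) ,
        (λ i j ij → φ-from _ _ (subst₂ (Adj G) (at i) (at j) (to i j ij))) ,
        (λ i j ij → from i j (subst₂ (Adj G) (sym (at i)) (sym (at j)) (φ-to _ _ ij))))
      (λ (_ , injective , onto , to , from) →
        (λ i → subst (_∈ S) (sym (at i)) (φ∈S _)) ,
        (λ i j eq → injective i j (φ-injective _ _ (trans (sym (at i)) (trans eq (at j))))) ,
        (λ v v∈S → let k , φk≡v = φ-onto v v∈S
                       i , ψi≡k = onto k ∈⊤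
                   in i , trans (at i) (trans (cong (lookup φ) ψi≡k) φk≡v)) ,
        (λ i j ij → subst₂ (Adj G) (sym (at i)) (sym (at j)) (φ-to _ _ (to i j ij))) ,
        (λ i j ij → from i j (φ-from _ _ (subst₂ (Adj G) (at i) (at j) ij))))
      where
      at : ∀ i → lookup (Vec.map (lookup φ) ψ) i ≡ lookup φ (lookup ψ i)
      at i = lookup-map i (lookup φ) ψ

    -- If `S` carries a copy, one isomorphism `φ` is fixed and all others are `φ` after an
    -- automorphism of `H`; otherwise both sides vanish.
    ∑ᵛ-isInducedIso : ∀ S → ∑ᵛ h (𝟙 ∘ does ∘ isInducedIso? H G S) ≡
                            automorphismCount H * 𝟙 (does (anyVec? (isInducedIso? H G S)))
    ∑ᵛ-isInducedIso S with anyVec? (isInducedIso? H G S)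
    ... | no ∄φ = trans
      (∑ᵛ-zero h λ φ → 𝟙-dec-false (isInducedIso? H G S φ) λ iso → ∄φ (φ , iso))
      (sym (ℕ.*-zeroʳ (automorphismCount H)))
    ... | yes (φ , iso@(_ , φ-injective , φ-onto , _)) = begin
      ∑ᵛ h (𝟙 ∘ does ∘ isInducedIso? H G S)
        -- Since `φ` is onto `S`, a tuple with an entry outside the range of `φ` leaves `S` and
        -- contributes nothing.
        ≡⟨ ∑ᵛ-reindex (lookup φ) (φ-injective _ _) h _
             (λ χ i χi∉φ → 𝟙-dec-false (isInducedIso? H G S χ) λ (χ∈S , _) →
               let j , φj≡χi = φ-onto _ (χ∈S i) in χi∉φ j φj≡χi) ⟩
      ∑ᵛ h (𝟙 ∘ does ∘ isInducedIso? H G S ∘ Vec.map (lookup φ))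
        ≡⟨ ∑ᵛ-cong h (λ ψ → 𝟙-dec-⇔ (isInducedIso-map S φ iso ψ)
             (isInducedIso? H G S (Vec.map (lookup φ) ψ)) (isInducedIso? H H ⊤ ψ)) ⟩
      automorphismCount H
        ≡⟨ ℕ.*-identityʳ (automorphismCount H) ⟨
      automorphismCount H * 1 ∎
      where open ≡-Reasoning

  -- Double counting of the pairs of a subset `S` and an isomorphism `φ` onto it: each embedding
  -- belongs to exactly one `S`, and each copy admits as many `φ` as `H` has automorphisms.
  ∑ᵛ-isEmbedding : (H : Graph h) (G : Graph n) → TwinFree H →
    ∑ᵛ h (𝟙 ∘ does ∘ isEmbedding? H G) ≡ automorphismCount H * inducedCount H G
  ∑ᵛ-isEmbedding {h} H G twinFree = begin
    ∑ᵛ h (𝟙 ∘ does ∘ isEmbedding? H G)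
      ≡⟨ ∑ᵛ-cong h (∑ˢ-isInducedIso H G twinFree) ⟨
    ∑ᵛ h (λ φ → ∑ˢ λ S → 𝟙 (does (isInducedIso? H G S φ)))
      ≡⟨ ∑ˢ-∑ᵛ-comm h (λ S φ → 𝟙 (does (isInducedIso? H G S φ))) ⟨
    ∑ˢ (λ S → ∑ᵛ h (𝟙 ∘ does ∘ isInducedIso? H G S))
      ≡⟨ ∑ˢ-cong (∑ᵛ-isInducedIso H G) ⟩
    ∑ˢ (λ S → automorphismCount H * 𝟙 (does (anyVec? (isInducedIso? H G S))))
      ≡⟨ *-distribˡ-∑ˢ (automorphismCount H) (λ S → 𝟙 (does (anyVec? (isInducedIso? H G S)))) ⟨
    automorphismCount H * ∑ˢ (λ S → 𝟙 (does (anyVec? (isInducedIso? H G S))))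
      ≡⟨ cong (automorphismCount H *_) (countSubsets≡∑ˢ (λ S → anyVec? (isInducedIso? H G S))) ⟨
    automorphismCount H * inducedCount H G ∎
    where open ≡-Reasoning

  -- Cliques as induced copies of complete graphs.

  complete : ∀ s → Graph s
  complete s = record
    { Adj     = _≢_
    ; adj?    = λ i j → ¬? (i ≟ j)
    ; adj-sym = ≢-sym
    ; irrefl  = λ i≡j i≢j → i≢j i≡j
    }

  -- The increasing enumeration of `S`. When `S` is a clique, its table of values is an isomorphism
  -- from the complete graph.
  enumerate : (S : Subset n) → Fin ∣ S ∣ → Fin n
  enumerate (inside  ∷ S) zero    = zero
  enumerate (inside  ∷ S) (suc i) = suc (enumerate S i)
  enumerate (outside ∷ S) i       = suc (enumerate S i)

  enumerate-∈ : ∀ (S : Subset n) i → enumerate S i ∈ S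
  enumerate-∈ (inside  ∷ S) zero    = here
  enumerate-∈ (inside  ∷ S) (suc i) = there (enumerate-∈ S i)
  enumerate-∈ (outside ∷ S) i       = there (enumerate-∈ S i)

  enumerate-injective : ∀ (S : Subset n) i j → enumerate S i ≡ enumerate S j → i ≡ j
  enumerate-injective (inside  ∷ S) zero    zero    eq = refl
  enumerate-injective (inside  ∷ S) (suc i) (suc j) eq =
    cong suc (enumerate-injective S i j (suc-injective eq))
  enumerate-injective (outside ∷ S) i       j       eq =
    enumerate-injective S i j (suc-injective eq)

  enumerate-onto : ∀ (S : Subset n) v → v ∈ S → ∃ λ i → enumerate S i ≡ v
  enumerate-onto (inside  ∷ S) zero    here        = zero , refl
  enumerate-onto (inside  ∷ S) (suc v) (there v∈S) =
    let i , eq = enumerate-onto S v v∈S in suc i , cong suc eq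
  enumerate-onto (outside ∷ S) (suc v) (there v∈S) =
    let i , eq = enumerate-onto S v v∈S in i , cong suc eq

  module _ (H : Graph h) (G : Graph n) where

    -- The size of `S` is the sum of its indicator, and reindexing along `φ` turns this into a sum
    -- of `h` ones.
    isInducedIso⇒∣S∣≡h : ∀ S φ → IsInducedIso H G S φ → ∣ S ∣ ≡ h
    isInducedIso⇒∣S∣≡h S φ (φ∈S , φ-injective , φ-onto , _) = begin
      ∣ S ∣                                 ≡⟨ ∑-lookup S ⟨
      ∑[ u < n ] 𝟙 (lookup S u)             ≡⟨ ∑-reindex (lookup φ) (φ-injective _ _) (𝟙 ∘ lookup S) off ⟩
      ∑[ i < h ] 𝟙 (lookup S (lookup φ i))  ≡⟨ sum-cong-≗ (λ i → cong 𝟙 (Vec.[]=⇒lookup (φ∈S i))) ⟩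
      ∑[ i < h ] 1                          ≡⟨ ∑-const h 1 ⟩
      h * 1                                 ≡⟨ ℕ.*-identityʳ h ⟩
      h                                     ∎
      where
      open ≡-Reasoning
      off : ∀ u → (∀ i → lookup φ i ≢ u) → 𝟙 (lookup S u) ≡ 0
      off u u∉φ with lookup S u in eq
      ... | false = refl
      ... | true  = let i , φi≡u = φ-onto u (Vec.lookup⇒[]= u S eq) in ⊥-elim (u∉φ i φi≡u)

  module _ (G : Graph n) where

    isClique⇔inducesComplete : ∀ S → IsClique G s S ⇔ InducesCopy (complete s) G S
    isClique⇔inducesComplete {s} S = mk⇔ to from
      where
      to : IsClique G s S → InducesCopy (complete s) G S
      -- Matching on `refl` identifies `s` with `∣ S ∣`, so that `enumerate S` has domain `Fin s`.
      to (refl , clique) = Vec.tabulate (enumerate S) ,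
        (λ i → subst (_∈ S) (sym (at i)) (enumerate-∈ S i)) ,
        (λ i j eq → enumerate-injective S i j (trans (sym (at i)) (trans eq (at j)))) ,
        (λ v v∈S → let i , eq = enumerate-onto S v v∈S in i , trans (at i) eq) ,
        (λ i j i≢j → subst₂ (Adj G) (sym (at i)) (sym (at j))
          (clique _ (enumerate-∈ S i) _ (enumerate-∈ S j) (i≢j ∘ enumerate-injective S i j))) ,
        (λ i j ij i≡j → irrefl G (cong (lookup (Vec.tabulate (enumerate S))) i≡j) ij)
        where
        at : ∀ i → lookup (Vec.tabulate (enumerate S)) i ≡ enumerate S i
        at = lookup∘tabulate (enumerate S)

      from : InducesCopy (complete s) G S → IsClique G s S
      from (φ , iso@(_ , _ , φ-onto , φ-adj , _)) =
        isInducedIso⇒∣S∣≡h (complete s) G S φ iso ,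
        λ u u∈S v v∈S u≢v →
          let i , φi≡u = φ-onto u u∈S
              j , φj≡v = φ-onto v v∈S
          in subst₂ (Adj G) φi≡u φj≡v
               (φ-adj i j λ i≡j → u≢v (trans (sym φi≡u) (trans (cong (lookup φ) i≡j) φj≡v)))

  k≡inducedCount : ∀ (G : Graph n) s → k G s ≡ inducedCount (complete s) G
  k≡inducedCount G s = begin
    k G s
      ≡⟨ countSubsets≡∑ˢ (isClique? G s) ⟩
    ∑ˢ (𝟙 ∘ does ∘ isClique? G s)
      ≡⟨ ∑ˢ-cong (λ S → 𝟙-dec-⇔ (isClique⇔inducesComplete G S)
           (isClique? G s S) (anyVec? (isInducedIso? (complete s) G S))) ⟩
    ∑ˢ (λ S → 𝟙 (does (anyVec? (isInducedIso? (complete s) G S))))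
      ≡⟨ countSubsets≡∑ˢ (λ S → anyVec? (isInducedIso? (complete s) G S)) ⟨
    inducedCount (complete s) G ∎
    where open ≡-Reasoning

  -- Ordered counts of triangles, copies of `K₄` and triangles with an isolated vertex.

  module _ (G : Graph n) where

    adjacent : Fin n → Fin n → Bool
    adjacent u v = does (adj? G u v)

    adjacent-sym : ∀ u v → adjacent u v ≡ adjacent v u
    adjacent-sym u v = does-⇔ (mk⇔ (adj-sym G) (adj-sym G)) (adj? G u v) (adj? G v u)

    adjacent-irrefl : ∀ u → adjacent u u ≡ false
    adjacent-irrefl u = dec-false (adj? G u u) (irrefl G refl)

    -- The decision procedure tests all ordered pairs. Rewriting removes the diagonal and the
    -- reversed pairs, and the remaining cases hold by evaluation. The next two lemmas work in the
    -- same way.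
    isEmbedding-K₃ : ∀ u v w → does (isEmbedding? (complete 3) G (u ∷ v ∷ w ∷ [])) ≡
      adjacent u v ∧ adjacent u w ∧ adjacent v w
    isEmbedding-K₃ u v w
      rewrite adjacent-irrefl u | adjacent-irrefl v | adjacent-irrefl w
            | adjacent-sym v u | adjacent-sym w u | adjacent-sym w v
      with adjacent u v | adjacent u w | adjacent v w
    ... | false | _ | _ = refl
    ... | true | false | _ = refl
    ... | true | true | false = refl
    ... | true | true | true = refl

    isEmbedding-K₄ : ∀ u v w x → does (isEmbedding? (complete 4) G (u ∷ v ∷ w ∷ x ∷ [])) ≡
      adjacent u v ∧ adjacent u w ∧ adjacent u x ∧ adjacent v w ∧ adjacent v x ∧ adjacent w x
    isEmbedding-K₄ u v w x
      rewrite adjacent-irrefl u | adjacent-irrefl v | adjacent-irrefl w | adjacent-irrefl x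
            | adjacent-sym v u | adjacent-sym w u | adjacent-sym w v
            | adjacent-sym x u | adjacent-sym x v | adjacent-sym x w
      with adjacent u v | adjacent u w | adjacent u x | adjacent v w | adjacent v x | adjacent w x
    ... | false | _ | _ | _ | _ | _ = refl
    ... | true | false | _ | _ | _ | _ = refl
    ... | true | true | false | _ | _ | _ = refl
    ... | true | true | true | false | _ | _ = refl
    ... | true | true | true | true | false | _ = refl
    ... | true | true | true | true | true | false = refl
    ... | true | true | true | true | true | true = refl

    isEmbedding-triangle+isolated : ∀ u v w x →
      does (isEmbedding? triangle+isolated G (u ∷ v ∷ w ∷ x ∷ [])) ≡
      adjacent u v ∧ adjacent u w ∧ adjacent v w ∧
      not (adjacent u x) ∧ not (adjacent v x) ∧ not (adjacent w x)
    isEmbedding-triangle+isolated u v w x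
      rewrite adjacent-irrefl u | adjacent-irrefl v | adjacent-irrefl w | adjacent-irrefl x
            | adjacent-sym v u | adjacent-sym w u | adjacent-sym w v
            | adjacent-sym x u | adjacent-sym x v | adjacent-sym x w
      with adjacent u v | adjacent u w | adjacent v w | adjacent u x | adjacent v x | adjacent w x
    ... | false | _ | _ | _ | _ | _ = refl
    ... | true | false | _ | _ | _ | _ = refl
    ... | true | true | false | _ | _ | _ = refl
    ... | true | true | true | true | _ | _ = refl
    ... | true | true | true | false | true | _ = refl
    ... | true | true | true | false | false | true = refl
    ... | true | true | true | false | false | false = refl

    -- The constant is `automorphismCount (complete 3)`, which evaluates to 6; the constants 24 and
    -- 6 of the next two counts arise likewise.
    k₃-count : 6 * k G 3 ≡ ∑[ u < n ] ∑[ v < n ] ∑[ w < n ]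
      𝟙 (adjacent u v ∧ adjacent u w ∧ adjacent v w)
    k₃-count = trans (cong (6 *_) (k≡inducedCount G 3)) (trans
      (sym (∑ᵛ-isEmbedding (complete 3) G (from-yes (twinFree? (complete 3)))))
      (sum-cong-≗ λ u → sum-cong-≗ λ v → sum-cong-≗ λ w → cong 𝟙 (isEmbedding-K₃ u v w)))

    k₄-count : 24 * k G 4 ≡ ∑[ u < n ] ∑[ v < n ] ∑[ w < n ] ∑[ x < n ]
      𝟙 (adjacent u v ∧ adjacent u w ∧ adjacent u x ∧ adjacent v w ∧ adjacent v x ∧ adjacent w x)
    k₄-count = trans (cong (24 *_) (k≡inducedCount G 4)) (trans
      (sym (∑ᵛ-isEmbedding (complete 4) G (from-yes (twinFree? (complete 4)))))
      (sum-cong-≗ λ u → sum-cong-≗ λ v → sum-cong-≗ λ w → sum-cong-≗ λ x →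
        cong 𝟙 (isEmbedding-K₄ u v w x)))

    k₄⁽³⁾-count : 6 * k₄⁽³⁾ G ≡ ∑[ u < n ] ∑[ v < n ] ∑[ w < n ] ∑[ x < n ]
      𝟙 (adjacent u v ∧ adjacent u w ∧ adjacent v w ∧
         not (adjacent u x) ∧ not (adjacent v x) ∧ not (adjacent w x))
    k₄⁽³⁾-count = trans
      (sym (∑ᵛ-isEmbedding triangle+isolated G (from-yes (twinFree? triangle+isolated))))
      (sum-cong-≗ λ u → sum-cong-≗ λ v → sum-cong-≗ λ w → sum-cong-≗ λ x →
        cong 𝟙 (isEmbedding-triangle+isolated u v w x))

  -- Triple sums, and list counts as sums.

  ∑-mono-≤ : {F F′ : Fin n → ℕ} → (∀ i → F i ≤ F′ i) → sum F ≤ sum F′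
  ∑-mono-≤ {zero}  F≤F′ = z≤n
  ∑-mono-≤ {suc n} F≤F′ = ℕ.+-mono-≤ (F≤F′ zero) (∑-mono-≤ (F≤F′ ∘ suc))

  ∑³ : (Fin n → Fin n → Fin n → ℕ) → ℕ
  ∑³ {n} F = ∑[ u < n ] ∑[ v < n ] ∑[ w < n ] F u v w

  ∑³-cong : {F F′ : Fin n → Fin n → Fin n → ℕ} → (∀ u v w → F u v w ≡ F′ u v w) → ∑³ F ≡ ∑³ F′
  ∑³-cong F≡F′ = sum-cong-≗ λ u → sum-cong-≗ λ v → sum-cong-≗ λ w → F≡F′ u v w

  ∑³-distrib-+ : (F F′ : Fin n → Fin n → Fin n → ℕ) →
                 ∑³ (λ u v w → F u v w + F′ u v w) ≡ ∑³ F + ∑³ F′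
  ∑³-distrib-+ {n} F F′ = trans
    (sum-cong-≗ λ u → trans
      (sum-cong-≗ λ v → ∑-distrib-+ (F u v) (F′ u v))
      (∑-distrib-+ (λ v → ∑[ w < n ] F u v w) (λ v → ∑[ w < n ] F′ u v w)))
    (∑-distrib-+ (λ u → ∑[ v < n ] ∑[ w < n ] F u v w) (λ u → ∑[ v < n ] ∑[ w < n ] F′ u v w))

  *-distribˡ-∑³ : ∀ c (F : Fin n → Fin n → Fin n → ℕ) → c * ∑³ F ≡ ∑³ (λ u v w → c * F u v w)
  *-distribˡ-∑³ {n} c F = trans
    (*-distribˡ-sum c (λ u → ∑[ v < n ] ∑[ w < n ] F u v w))
    (sum-cong-≗ λ u → trans
      (*-distribˡ-sum c (λ v → ∑[ w < n ] F u v w))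
      (sum-cong-≗ λ v → *-distribˡ-sum c (F u v)))

  ∑³-swap : (F : Fin n → Fin n → Fin n → ℕ) → ∑³ F ≡ ∑³ (λ u v w → F v u w)
  ∑³-swap {n} F = ∑-comm (λ u v → ∑[ w < n ] F u v w)

  ∑³-rotate : (F : Fin n → Fin n → Fin n → ℕ) → ∑³ F ≡ ∑³ (λ u v w → F v w u)
  ∑³-rotate {n} F = trans
    (sum-cong-≗ λ u → ∑-comm (F u))
    (∑-comm (λ u w → ∑[ v < n ] F u v w))

  -- A general `f` in place of the identity of `allFin` lets the induction pass to `f ∘ suc`.
  length-filter-tabulate : ∀ {A : Set} {P : A → Set} (P? : U.Decidable P) (f : Fin n → A) →
    length (filter P? (List.tabulate f)) ≡ ∑[ i < n ] 𝟙 (does (P? (f i)))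
  length-filter-tabulate {zero}  P? f = refl
  length-filter-tabulate {suc n} P? f with does (P? (f zero))
  ... | true  = cong suc (length-filter-tabulate P? (f ∘ suc))
  ... | false = length-filter-tabulate P? (f ∘ suc)

  length-filter-cartesianProduct :
    ∀ {A B : Set} {P : A × B → Set} (P? : U.Decidable P) (f : Fin m → A) (g : Fin n → B) →
    length (filter P? (cartesianProduct (List.tabulate f) (List.tabulate g))) ≡
    ∑[ i < m ] ∑[ j < n ] 𝟙 (does (P? (f i , g j)))
  length-filter-cartesianProduct {zero}  P? f g = refl
  length-filter-cartesianProduct {suc m} P? f g = trans
    (length-filter-++ P? (List.map (f zero ,_) (List.tabulate g)) _)
    (cong₂ _+_
      (trans (length-filter-map P? (f zero ,_) (List.tabulate g))
             (length-filter-tabulate (P? ∘ (f zero ,_)) g))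
      (length-filter-cartesianProduct P? (f ∘ suc) g))

  sumᴸ-map-tabulate : ∀ {A : Set} (f : A → ℕ) (g : Fin n → A) →
                      sumᴸ (List.map f (List.tabulate g)) ≡ ∑[ i < n ] f (g i)
  sumᴸ-map-tabulate {zero}  f g = refl
  sumᴸ-map-tabulate {suc n} f g = cong (f (g zero) +_) (sumᴸ-map-tabulate f (g ∘ suc))

  -- Edges, degrees and codegrees as sums of indicators.

  module _ (G : Graph n) where

    private
      a : Fin n → Fin n → Bool
      a = adjacent G

    -- `edges` lists each edge in one order only; adding the transposed sum supplies the other, and
    -- the diagonal is empty by irreflexivity.
    2*edgeCount : 2 * edgeCount G ≡ ∑[ u < n ] ∑[ v < n ] 𝟙 (a u v)
    2*edgeCount = begin
      2 * edgeCount G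
        ≡⟨ cong (2 *_) (length-filter-cartesianProduct
             (uncurry λ u v → (u <? v) ×-dec adj? G u v) id id) ⟩
      2 * E
        ≡⟨ cong (E +_) (trans (ℕ.+-identityʳ E) (∑-comm edge)) ⟩
      E + ∑[ u < n ] ∑[ v < n ] edge v u
        ≡⟨ ∑-distrib-+ (λ u → sum (edge u)) (λ u → ∑[ v < n ] edge v u) ⟨
      ∑[ u < n ] (sum (edge u) + ∑[ v < n ] edge v u)
        ≡⟨ sum-cong-≗ (λ u → trans (sym (∑-distrib-+ (edge u) (λ v → edge v u)))
                                   (sum-cong-≗ (both-orders u))) ⟩
      ∑[ u < n ] ∑[ v < n ] 𝟙 (a u v) ∎
      where
      open ≡-Reasoning
      edge : Fin n → Fin n → ℕ
      edge u v = 𝟙 (does ((u <? v) ×-dec adj? G u v))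

      E : ℕ
      E = ∑[ u < n ] ∑[ v < n ] edge u v

      both-orders : ∀ u v → edge u v + edge v u ≡ 𝟙 (a u v)
      both-orders u v with <-cmp u v
      ... | tri< u<v _ v≮u
        rewrite dec-true (u <? v) u<v | dec-false (v <? u) v≮u = ℕ.+-identityʳ (𝟙 (a u v))
      ... | tri> u≮v _ v<u
        rewrite dec-false (u <? v) u≮v | dec-true (v <? u) v<u = cong 𝟙 (adjacent-sym G v u)
      ... | tri≈ u≮u refl _
        rewrite dec-false (u <? u) u≮u = cong 𝟙 (sym (adjacent-irrefl G u))

    degree≡∑ : ∀ v → degree G v ≡ ∑[ u < n ] 𝟙 (a v u)
    degree≡∑ v = trans (sym (∑-lookup (neighbours G v)))
                       (sum-cong-≗ λ u → cong 𝟙 (lookup∘tabulate (a v) u))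

    codegree≡∑ : ∀ u v → codegree G u v ≡ ∑[ w < n ] 𝟙 (a u w ∧ a v w)
    codegree≡∑ u v = trans (sym (∑-lookup (neighbours G u ∩ neighbours G v)))
      (sum-cong-≗ λ w → cong 𝟙 (trans (lookup-zipWith _∧_ w (neighbours G u) (neighbours G v))
        (cong₂ _∧_ (lookup∘tabulate (a u) w) (lookup∘tabulate (a v) w))))

    -- The square of the degree of `u` counts ordered pairs of neighbours of `u`, equal ones
    -- included.
    sumSquaredDegrees≡∑³ : sumSquaredDegrees G ≡ ∑³ λ u v x → 𝟙 (a u v ∧ a u x)
    sumSquaredDegrees≡∑³ = trans
      (sumᴸ-map-tabulate (λ v → degree G v ^ 2) id) (sum-cong-≗ square)
      where
      open ≡-Reasoning
      square : ∀ u → degree G u ^ 2 ≡ ∑[ v < n ] ∑[ x < n ] 𝟙 (a u v ∧ a u x)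
      square u = begin
        degree G u ^ 2
          ≡⟨ cong (degree G u *_) (ℕ.*-identityʳ (degree G u)) ⟩
        degree G u * degree G u
          ≡⟨ cong₂ _*_ (degree≡∑ u) (degree≡∑ u) ⟩
        (∑[ v < n ] 𝟙 (a u v)) * (∑[ x < n ] 𝟙 (a u x))
          ≡⟨ *-distribʳ-sum (∑[ x < n ] 𝟙 (a u x)) (λ v → 𝟙 (a u v)) ⟩
        ∑[ v < n ] (𝟙 (a u v) * ∑[ x < n ] 𝟙 (a u x))
          ≡⟨ sum-cong-≗ (λ v → trans (*-distribˡ-sum (𝟙 (a u v)) (λ x → 𝟙 (a u x)))
               (sum-cong-≗ λ x → sym (𝟙-∧ (a u v) (a u x)))) ⟩
        ∑[ v < n ] ∑[ x < n ] 𝟙 (a u v ∧ a u x) ∎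

    codegree≤bk-< : ∀ u v → u < v → Adj G u v → codegree G u v ≤ bk G
    codegree≤bk-< u v u<v uv = All.lookup (xs≤max 0 (List.map (uncurry (codegree G)) (edges G)))
      (∈-map⁺ (uncurry (codegree G))
        (∈-filter⁺ (uncurry λ u v → (u <? v) ×-dec adj? G u v)
                   (∈-cartesianProduct⁺ (∈-allFin u) (∈-allFin v)) (u<v , uv)))

    codegree≤bk : ∀ u v → Adj G u v → codegree G u v ≤ bk G
    codegree≤bk u v uv with <-cmp u v
    ... | tri< u<v _ _ = codegree≤bk-< u v u<v uv
    ... | tri≈ _ u≡v _ = ⊥-elim (irrefl G u≡v uv)
    ... | tri> _ _ v<u = subst (_≤ bk G) (cong ∣_∣ (∩-comm (neighbours G v) (neighbours G u)))
                                         (codegree≤bk-< v u v<u (adj-sym G uv))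

    -- Agreement of vertices with edges and triangles.

    triangle : Fin n → Fin n → Fin n → Bool
    triangle u v w = a u v ∧ a u w ∧ a v w

    agree : Fin n → Fin n → Fin n → Bool
    agree u v x = not (a u x xor a v x)

    agreeing : Fin n → Fin n → ℕ
    agreeing u v = ∑[ x < n ] 𝟙 (agree u v x)

    -- Edges are ordered here, so every agreeing pair of a vertex and an edge is counted twice.
    edgeAgreement : ℕ
    edgeAgreement = ∑³ λ u v x → 𝟙 (a u v ∧ agree u v x)

    -- The first two vertices of the ordered triangle mark its edge, so every triple of a triangle,
    -- one of its edges and a vertex agreeing with that edge is counted twice.
    triangleAgreement : ℕ
    triangleAgreement = ∑³ λ u v w → 𝟙 (triangle u v w) * agreeing u v

    -- For an edge `uv` and bits `p`, `q` telling whether `x` is adjacent to `u` and to `v`, the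
    -- indicator of `p = q` plus `p + q` equals `1 + 2pq`. Summing `p` or `q` gives the squared
    -- degrees, which stay on the left to avoid subtraction in `ℕ`.
    edgeAgreement≡ : edgeAgreement + 2 * sumSquaredDegrees G ≡
                     n * (2 * edgeCount G) + 2 * (6 * k G 3)
    edgeAgreement≡ = begin
      edgeAgreement + 2 * D
        ≡⟨ cong (λ z → edgeAgreement + (D + z)) (ℕ.+-identityʳ D) ⟩
      edgeAgreement + (D + D)
        ≡⟨ cong (edgeAgreement +_) (cong₂ _+_ sumSquaredDegrees≡∑³ D≡) ⟩
      edgeAgreement + (∑³ (λ u v x → 𝟙 (a u v ∧ a u x)) + ∑³ (λ u v x → 𝟙 (a u v ∧ a v x)))
        ≡⟨ cong (edgeAgreement +_) (∑³-distrib-+ (λ u v x → 𝟙 (a u v ∧ a u x))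
                                                 (λ u v x → 𝟙 (a u v ∧ a v x))) ⟨
      edgeAgreement + ∑³ (λ u v x → 𝟙 (a u v ∧ a u x) + 𝟙 (a u v ∧ a v x))
        ≡⟨ ∑³-distrib-+ (λ u v x → 𝟙 (a u v ∧ agree u v x))
                        (λ u v x → 𝟙 (a u v ∧ a u x) + 𝟙 (a u v ∧ a v x)) ⟨
      ∑³ (λ u v x → 𝟙 (a u v ∧ agree u v x) + (𝟙 (a u v ∧ a u x) + 𝟙 (a u v ∧ a v x)))
        ≡⟨ ∑³-cong (λ u v x → pointwise (a u v) (a u x) (a v x)) ⟩
      ∑³ (λ u v x → 𝟙 (a u v) + 2 * 𝟙 (triangle u v x))
        ≡⟨ ∑³-distrib-+ (λ u v x → 𝟙 (a u v)) (λ u v x → 2 * 𝟙 (triangle u v x)) ⟩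
      ∑³ (λ u v x → 𝟙 (a u v)) + ∑³ (λ u v x → 2 * 𝟙 (triangle u v x))
        ≡⟨ cong₂ _+_ (sym nm≡) (sym (*-distribˡ-∑³ 2 (λ u v x → 𝟙 (triangle u v x)))) ⟩
      n * (2 * edgeCount G) + 2 * ∑³ (λ u v x → 𝟙 (triangle u v x))
        ≡⟨ cong (λ z → n * (2 * edgeCount G) + 2 * z) (k₃-count G) ⟨
      n * (2 * edgeCount G) + 2 * (6 * k G 3) ∎
      where
      open ≡-Reasoning
      D : ℕ
      D = sumSquaredDegrees G

      D≡ : D ≡ ∑³ λ u v x → 𝟙 (a u v ∧ a v x)
      D≡ = trans sumSquaredDegrees≡∑³ (trans (∑³-swap (λ u v x → 𝟙 (a u v ∧ a u x)))
        (∑³-cong λ u v x → cong (λ b → 𝟙 (b ∧ a v x)) (adjacent-sym G v u)))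

      nm≡ : n * (2 * edgeCount G) ≡ ∑³ λ u v x → 𝟙 (a u v)
      nm≡ = trans (cong (n *_) 2*edgeCount) (trans
        (*-distribˡ-sum n (λ u → ∑[ v < n ] 𝟙 (a u v)))
        (sum-cong-≗ λ u → trans (*-distribˡ-sum n (λ v → 𝟙 (a u v)))
                                (sum-cong-≗ λ v → sym (∑-const n (𝟙 (a u v))))))

      pointwise : ∀ uv ux vx → 𝟙 (uv ∧ not (ux xor vx)) + (𝟙 (uv ∧ ux) + 𝟙 (uv ∧ vx)) ≡
                               𝟙 uv + 2 * 𝟙 (uv ∧ ux ∧ vx)
      pointwise false _     _     = refl
      pointwise true  false false = refl
      pointwise true  false true  = refl
      pointwise true  true  false = refl
      pointwise true  true  true  = refl

    -- For a fixed edge `uv` the factor `agreeing u v` does not depend on `w`, and summing the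
    -- triangle indicator over `w` leaves the codegree, which is at most `bk G`.
    triangleAgreement≤ : triangleAgreement ≤ bk G * edgeAgreement
    triangleAgreement≤ = begin
      triangleAgreement
        ≤⟨ ∑-mono-≤ (λ u → ∑-mono-≤ (onEdge u)) ⟩
      ∑[ u < n ] ∑[ v < n ] (bk G * ∑[ x < n ] 𝟙 (a u v ∧ agree u v x))
        ≡⟨ sum-cong-≗ (λ u → *-distribˡ-sum (bk G) (λ v → ∑[ x < n ] 𝟙 (a u v ∧ agree u v x))) ⟨
      ∑[ u < n ] (bk G * ∑[ v < n ] ∑[ x < n ] 𝟙 (a u v ∧ agree u v x))
        ≡⟨ *-distribˡ-sum (bk G) (λ u → ∑[ v < n ] ∑[ x < n ] 𝟙 (a u v ∧ agree u v x)) ⟨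
      bk G * edgeAgreement ∎
      where
      open ℕ.≤-Reasoning
      onEdge : ∀ u v → ∑[ w < n ] (𝟙 (triangle u v w) * agreeing u v) ≤
                       bk G * ∑[ x < n ] 𝟙 (a u v ∧ agree u v x)
      onEdge u v with adj? G u v
      -- If `uv` is not an edge, it lies in no triangle and the left side is zero.
      ... | no _ = ℕ.≤-trans (ℕ.≤-reflexive (∑-zero {n} λ _ → refl)) z≤n
      ... | yes uv = begin
        ∑[ w < n ] (𝟙 (a u w ∧ a v w) * agreeing u v)
          ≡⟨ *-distribʳ-sum (agreeing u v) (λ w → 𝟙 (a u w ∧ a v w)) ⟨
        (∑[ w < n ] 𝟙 (a u w ∧ a v w)) * agreeing u v
          ≡⟨ cong (_* agreeing u v) (codegree≡∑ u v) ⟨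
        codegree G u v * agreeing u v
          ≤⟨ ℕ.*-monoˡ-≤ (agreeing u v) (codegree≤bk u v uv) ⟩
        bk G * agreeing u v ∎

    -- Three copies of the sum are rotated so that `uv`, `vw` and `wu` are marked in turn. For each
    -- triangle all three edges can then be compared with the same vertex `x`.
    3*triangleAgreement : 3 * triangleAgreement ≡
                          n * (6 * k G 3) + (2 * (24 * k G 4) + 2 * (6 * k₄⁽³⁾ G))
    3*triangleAgreement = begin
      3 * triangleAgreement
        ≡⟨ cong (λ z → Y + (Y + z)) (ℕ.+-identityʳ Y) ⟩
      Y + (Y + Y)
        ≡⟨ cong₂ (λ y z → Y + (y + z)) (∑³-rotate F)
             (trans (∑³-rotate F) (∑³-rotate (λ u v w → F v w u))) ⟩
      Y + (∑³ (λ u v w → F v w u) + ∑³ (λ u v w → F w u v))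
        ≡⟨ cong (Y +_) (∑³-distrib-+ (λ u v w → F v w u) (λ u v w → F w u v)) ⟨
      Y + ∑³ (λ u v w → F v w u + F w u v)
        ≡⟨ ∑³-distrib-+ F (λ u v w → F v w u + F w u v) ⟨
      ∑³ (λ u v w → F u v w + (F v w u + F w u v))
        ≡⟨ ∑³-cong onTriangle ⟩
      ∑³ (λ u v w → n * 𝟙 (triangle u v w) + (2 * K u v w + 2 * I u v w))
        ≡⟨ ∑³-distrib-+ (λ u v w → n * 𝟙 (triangle u v w)) (λ u v w → 2 * K u v w + 2 * I u v w) ⟩
      ∑³ (λ u v w → n * 𝟙 (triangle u v w)) + ∑³ (λ u v w → 2 * K u v w + 2 * I u v w)
        ≡⟨ cong₂ _+_ (sym (*-distribˡ-∑³ n (λ u v w → 𝟙 (triangle u v w))))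
             (trans (∑³-distrib-+ (λ u v w → 2 * K u v w) (λ u v w → 2 * I u v w))
                    (sym (cong₂ _+_ (*-distribˡ-∑³ 2 K) (*-distribˡ-∑³ 2 I)))) ⟩
      n * ∑³ (λ u v w → 𝟙 (triangle u v w)) + (2 * ∑³ K + 2 * ∑³ I)
        ≡⟨ cong₂ _+_ (cong (n *_) (k₃-count G))
             (cong₂ (λ y z → 2 * y + 2 * z) (k₄-count G) (k₄⁽³⁾-count G)) ⟨
      n * (6 * k G 3) + (2 * (24 * k G 4) + 2 * (6 * k₄⁽³⁾ G)) ∎
      where
      open ≡-Reasoning
      F : Fin n → Fin n → Fin n → ℕ
      F u v w = 𝟙 (triangle u v w) * agreeing u v

      Y : ℕ
      Y = ∑³ F

      κ ι : Fin n → Fin n → Fin n → Fin n → ℕ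
      κ u v w x = 𝟙 (a u v ∧ a u w ∧ a u x ∧ a v w ∧ a v x ∧ a w x)
      ι u v w x = 𝟙 (a u v ∧ a u w ∧ a v w ∧ not (a u x) ∧ not (a v x) ∧ not (a w x))

      K I : Fin n → Fin n → Fin n → ℕ
      K u v w = ∑[ x < n ] κ u v w x
      I u v w = ∑[ x < n ] ι u v w x

      -- Of the three adjacency bits between `x` and a triangle, either all are equal and three
      -- pairs agree, or exactly one pair agrees. This is `1`, plus `2` when `x` is adjacent to all
      -- or to none.
      onVertex : ∀ u v w x →
        𝟙 (triangle u v w) * (𝟙 (agree u v x) + (𝟙 (agree v w x) + 𝟙 (agree w u x))) ≡
        𝟙 (triangle u v w) + (2 * κ u v w x + 2 * ι u v w x)
      onVertex u v w x with a u v | a u w | a v w | a u x | a v x | a w x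
      ... | false | _     | _     | _     | _     | _     = refl
      ... | true  | false | _     | _     | _     | _     = refl
      -- `κ` tests `a u x` before `a v w`, so it reduces only after a split on `a u x`.
      ... | true  | true  | false | true  | _     | _     = refl
      ... | true  | true  | false | false | _     | _     = refl
      ... | true  | true  | true  | false | false | false = refl
      ... | true  | true  | true  | false | false | true  = refl
      ... | true  | true  | true  | false | true  | false = refl
      ... | true  | true  | true  | false | true  | true  = refl
      ... | true  | true  | true  | true  | false | false = refl
      ... | true  | true  | true  | true  | false | true  = refl
      ... | true  | true  | true  | true  | true  | false = refl
      ... | true  | true  | true  | true  | true  | true  = refl

      triangle-rotate : ∀ u v w → triangle v w u ≡ triangle u v w
      triangle-rotate u v w rewrite adjacent-sym G v u | adjacent-sym G w u =
        trans (Bool.∧-comm (a v w) (a u v ∧ a u w)) (Bool.∧-assoc (a u v) (a u w) (a v w))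

      onTriangle : ∀ u v w → F u v w + (F v w u + F w u v) ≡
                             n * 𝟙 (triangle u v w) + (2 * K u v w + 2 * I u v w)
      onTriangle u v w = begin
        F u v w + (F v w u + F w u v)
          ≡⟨ cong₂ (λ y z → F u v w + (𝟙 y * agreeing v w + 𝟙 z * agreeing w u))
               (triangle-rotate u v w) (sym (triangle-rotate w u v)) ⟩
        t * agreeing u v + (t * agreeing v w + t * agreeing w u)
          ≡⟨ cong (t * agreeing u v +_) (ℕ.*-distribˡ-+ t (agreeing v w) (agreeing w u)) ⟨
        t * agreeing u v + t * (agreeing v w + agreeing w u)
          ≡⟨ ℕ.*-distribˡ-+ t (agreeing u v) (agreeing v w + agreeing w u) ⟨
        t * (agreeing u v + (agreeing v w + agreeing w u))
          ≡⟨ cong (t *_) (trans (cong (agreeing u v +_) (sym (∑-distrib-+ _ (λ x → 𝟙 (agree w u x)))))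
                                (sym (∑-distrib-+ (λ x → 𝟙 (agree u v x)) _))) ⟩
        t * ∑[ x < n ] (𝟙 (agree u v x) + (𝟙 (agree v w x) + 𝟙 (agree w u x)))
          ≡⟨ *-distribˡ-sum t (λ x → 𝟙 (agree u v x) + (𝟙 (agree v w x) + 𝟙 (agree w u x))) ⟩
        ∑[ x < n ] (t * (𝟙 (agree u v x) + (𝟙 (agree v w x) + 𝟙 (agree w u x))))
          ≡⟨ sum-cong-≗ (onVertex u v w) ⟩
        ∑[ x < n ] (t + (2 * κ u v w x + 2 * ι u v w x))
          ≡⟨ ∑-distrib-+ (λ _ → t) (λ x → 2 * κ u v w x + 2 * ι u v w x) ⟩
        ∑[ x < n ] t + ∑[ x < n ] (2 * κ u v w x + 2 * ι u v w x)
          ≡⟨ cong₂ _+_ (∑-const n t) (∑-distrib-+ (λ x → 2 * κ u v w x) (λ x → 2 * ι u v w x)) ⟩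
        n * t + ((∑[ x < n ] (2 * κ u v w x)) + (∑[ x < n ] (2 * ι u v w x)))
          ≡⟨ cong (n * t +_) (cong₂ _+_ (*-distribˡ-sum 2 (κ u v w)) (*-distribˡ-sum 2 (ι u v w))) ⟨
        n * t + (2 * K u v w + 2 * I u v w) ∎
        where
        t : ℕ
        t = 𝟙 (triangle u v w)

-- Passage to the integers and the final inequality.

open Counting
open import Data.Integer using (+_; _+_; _-_; _*_; _≥_; +≤+)

-- The cast from `ℕ` to `ℤ` commutes with addition by computation, so only products need rewriting.
pos-*-* : ∀ x y z → + (x ℕ.* (y ℕ.* z)) ≡ + x * (+ y * + z)
pos-*-* x y z = trans (ℤ.pos-* x (y ℕ.* z)) (cong (+ x *_) (ℤ.pos-* y z))

module _ {n : ℕ} (G : Graph n) where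

  edgeAgreementℤ : + edgeAgreement G ≡
    + 2 * (+ 6 * + k G 3 - + sumSquaredDegrees G + + n * + edgeCount G)
  edgeAgreementℤ = begin
    x                                      ≡⟨ add-sub x d ⟩
    x + + 2 * d - + 2 * d                  ≡⟨ cong (λ z → x + z - + 2 * d) (ℤ.pos-* 2 D) ⟨
    + (X ℕ.+ 2 ℕ.* D) - + 2 * d            ≡⟨ cong (λ z → + z - + 2 * d) (edgeAgreement≡ G) ⟩
    + (n ℕ.* (2 ℕ.* m) ℕ.+ 2 ℕ.* (6 ℕ.* t)) - + 2 * d
      ≡⟨ cong (_- + 2 * d) (cong₂ _+_ (pos-*-* n 2 m) (pos-*-* 2 6 t)) ⟩
    + n * (+ 2 * + m) + + 2 * (+ 6 * + t) - + 2 * d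
      ≡⟨ collect (+ n) (+ m) (+ t) d ⟩
    + 2 * (+ 6 * + t - d + + n * + m)      ∎
    where
    open ≡-Reasoning
    X = edgeAgreement G
    D = sumSquaredDegrees G
    m = edgeCount G
    t = k G 3
    x = + X
    d = + D

    add-sub : ∀ x d → x ≡ x + + 2 * d - + 2 * d
    add-sub = solve-∀

    collect : ∀ n m t d → n * (+ 2 * m) + + 2 * (+ 6 * t) - + 2 * d ≡
                          + 2 * (+ 6 * t - d + n * m)
    collect = solve-∀

theorem1 : ∀ {n : ℕ} (G : Graph n) →
    (+ 6 * + k G 3 - + sumSquaredDegrees G + + n * + edgeCount G) * + bk G
    ≥ + n * + k G 3 + + 8 * + k G 4 + + 2 * + k₄⁽³⁾ G
-- The factor 6 is 3 for the choice of the marked edge in a triangle times 2 for the order of its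
-- ends.
theorem1 {n} G = ℤ.*-cancelˡ-≤-pos _ _ (+ 6) (begin
  + 6 * (+ n * + t + + 8 * + q + + 2 * + p)
    ≡⟨ expand (+ n) (+ t) (+ q) (+ p) ⟩
  + n * (+ 6 * + t) + (+ 2 * (+ 24 * + q) + + 2 * (+ 6 * + p))
    ≡⟨ cong₂ _+_ (pos-*-* n 6 t) (cong₂ _+_ (pos-*-* 2 24 q) (pos-*-* 2 6 p)) ⟨
  + (n ℕ.* (6 ℕ.* t) ℕ.+ (2 ℕ.* (24 ℕ.* q) ℕ.+ 2 ℕ.* (6 ℕ.* p)))
    ≡⟨ cong +_ (3*triangleAgreement G) ⟨
  + (3 ℕ.* triangleAgreement G)
    ≤⟨ +≤+ (ℕ.*-monoʳ-≤ 3 (triangleAgreement≤ G)) ⟩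
  + (3 ℕ.* (bk G ℕ.* edgeAgreement G))
    ≡⟨ pos-*-* 3 (bk G) (edgeAgreement G) ⟩
  + 3 * (+ bk G * + edgeAgreement G)
    ≡⟨ cong (λ x → + 3 * (+ bk G * x)) (edgeAgreementℤ G) ⟩
  + 3 * (+ bk G * (+ 2 * Z))
    ≡⟨ regroup (+ bk G) Z ⟩
  + 6 * (Z * + bk G) ∎)
  where
  open ℤ.≤-Reasoning
  t = k G 3
  q = k G 4
  p = k₄⁽³⁾ G
  Z = + 6 * + t - + sumSquaredDegrees G + + n * + edgeCount G

  expand : ∀ n t q p → + 6 * (n * t + + 8 * q + + 2 * p) ≡
                       n * (+ 6 * t) + (+ 2 * (+ 24 * q) + + 2 * (+ 6 * p))
  expand = solve-∀

  regroup : ∀ b z → + 3 * (b * (+ 2 * z)) ≡ + 6 * (z * b)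
  regroup = solve-∀
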